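{- Let $u\in\mathbb{N}$ and $q\in(1/u,1)$. If a permutation matrix $P$ satisfies $\mathrm{ex}(u,P) < q u^2$, then \[ c_P \le 2u^3\, u^{\lceil -\log u/\log q\rceil}. \]
   Context: A binary matrix has entries in $\{0,1\}$; a permutation matrix is a square binary matrix with exactly one $1$-entry in every row and every column. A binary matrix $A$ contains a binary matrix $B$ if $B$ can be obtained from $A$ by deleting some rows, some columns, and changing some $1$-entries to $0$-entries; otherwise $A$ avoids $B$. $\mathrm{ex}(n,P)$ is the maximum number of $1$-entries in an $n\times n$ binary matrix avoiding $P$. The Füredi--Hajnal limit is $c_P=\lim_{n\to\infty}\mathrm{ex}(n,P)/n$ (this limit exists and is finite). Logarithms are base $2$. -}

module Defs where

open import Data.Nat using (ℕ; zero; suc; _+_; _*_; _^_; _≤_; _<_)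
open import Data.Fin using (Fin; toℕ)
import Data.Fin as F
open import Data.Bool using (Bool; true; false)
open import Data.Product using (Σ; ∃; _×_; _,_)
open import Relation.Nullary using (¬_)
open import Relation.Binary.PropositionalEquality using (_≡_)
open import Data.List using (List; map; allFin)
open import Data.Nat.ListAction using (sum)

Matrix : ℕ → ℕ → Set
Matrix m n = Fin m → Fin n → Bool

SqMatrix : ℕ → Set
SqMatrix n = Matrix n n

ExactlyOneInRow : ∀ {k} → SqMatrix k → Fin k → Set
ExactlyOneInRow {k} P i =
  Σ (Fin k) λ j → (P i j ≡ true) × (∀ j′ → P i j′ ≡ true → j′ ≡ j)

ExactlyOneInCol : ∀ {k} → SqMatrix k → Fin k → Set
ExactlyOneInCol {k} P j =
  Σ (Fin k) λ i → (P i j ≡ true) × (∀ i′ → P i′ j ≡ true → i′ ≡ i)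

IsPermutationMatrix : ∀ {k} → SqMatrix k → Set
IsPermutationMatrix {k} P =
  (∀ i → ExactlyOneInRow P i) × (∀ j → ExactlyOneInCol P j)

StrictlyIncreasing : ∀ {a b} → (Fin a → Fin b) → Set
StrictlyIncreasing {a} f = ∀ (i j : Fin a) → i F.< j → f i F.< f j

-- A contains B: B is obtained from A by deleting rows and columns and
-- changing some 1-entries to 0-entries.
Contains : ∀ {m n k l} → Matrix m n → Matrix k l → Set
Contains {m} {n} {k} {l} A B =
  Σ (Fin k → Fin m) λ r → Σ (Fin l → Fin n) λ c →
    StrictlyIncreasing r × StrictlyIncreasing c ×
    (∀ i j → B i j ≡ true → A (r i) (c j) ≡ true)

Avoids : ∀ {m n k l} → Matrix m n → Matrix k l → Set
Avoids A B = ¬ Contains A B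

b2n : Bool → ℕ
b2n true  = 1
b2n false = 0

ones : ∀ {m n} → Matrix m n → ℕ
ones {m} {n} A = sum (map (λ i → sum (map (λ j → b2n (A i j)) (allFin n))) (allFin m))

IsEx : ∀ {k} → ℕ → SqMatrix k → ℕ → Set
IsEx n P e =
  (Σ (SqMatrix n) λ A → Avoids A P × ones A ≡ e) ×
  (∀ (A : SqMatrix n) → Avoids A P → ones A ≤ e)

-- c_P ≤ K  (the Füredi–Hajnal limit lim ex(n,P)/n, which exists, is at most K):
-- for every ε = 1/d > 0, eventually ex(n,P)/n ≤ K + 1/d.
FHLimitAtMost : ∀ {k} → SqMatrix k → ℕ → Set
FHLimitAtMost P K =
  ∀ (d : ℕ) → 1 ≤ d →
    Σ ℕ λ N → ∀ n → N ≤ n → ∀ e → IsEx n P e → d * e ≤ (d * K + 1) * n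

-- IsCeilLogRatio u a b t : t = ⌈ -log u / log (a/b) ⌉ = ⌈ log u / log (b/a) ⌉
-- for 0 < a < b; i.e. t is the least natural number with (b/a)^t ≥ u,
-- i.e. with u * a^t ≤ b^t.
IsCeilLogRatio : ℕ → ℕ → ℕ → ℕ → Set
IsCeilLogRatio u a b t = (u * a ^ t ≤ b ^ t) × (∀ s → u * a ^ s ≤ b ^ s → t ≤ s)

{-# OPTIONS --safe #-}

-- Let A avoid P and have u^t rows, each with at least u ones. Split the rows into u consecutive
-- groups and contract each group to one row: the u × n contraction avoids P, so by comparison with
-- its u heaviest columns its density on the N nonempty columns is below q = a / b. Iterating over
-- t levels gives u < q^t N, hence N > u² as soon as u q^t ≤ 1.
--
-- Cut an n × n matrix avoiding P into blocks of side u². By the above, each column of blocks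
-- contains at most u^t blocks with u or more nonempty columns, and symmetrically for rows of
-- blocks. Such blocks have at most u⁴ ones; the other nonempty blocks have at most (u − 1)² ones,
-- and their number is bounded since the contracted matrix avoids P. With m the number of blocks
-- per side, ex(n) ≤ (u − 1)² ex(m) + 2 m u^t u⁴, and ex(n) ≤ 2 u^(3+t) n follows by induction.
module Submission where

open import Defs
open import Data.Nat using (ℕ; _+_; _*_; _^_; _≤_; _<_)
open import Data.Product using (_×_)
open import Data.Nat.Properties
open import Algebra.Properties.Semiring.Sum Data.Nat.Properties.+-*-semiring using (sum; sum-cong-≗; ∑-distrib-+; ∑-comm; *-distribˡ-sum; *-distribʳ-sum)
open import Data.Bool using (Bool; true; false; _∧_)
import Data.Bool.Properties as Bool
open import Data.Fin using (Fin; zero; suc; combine; quotient; remainder; inject≤; fromℕ<; toℕ; lift)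
import Data.Fin as F
import Data.Fin.Properties as F
open import Data.List using (map; allFin; tabulate)
open import Data.List.Properties using (map-tabulate)
import Data.Nat.ListAction as List
open import Data.Nat using (zero; suc; z≤n; s≤s; z<s; s<s; s≤s⁻¹; s<s⁻¹; NonZero; pred; >-nonZero; >-nonZero⁻¹; _/_; _%_)
open import Data.Nat.DivMod using (m≡m%n+[m/n]*n; m%n<n; m/n*n≤m)
open import Data.Nat.Induction using (<-rec)
open import Data.Nat.Tactic.RingSolver using (solve-∀)
open import Data.Product using (Σ; ∃; ∃₂; _,_; proj₁; proj₂; swap)
open import Function using (_∘_; flip; id)
open import Relation.Binary.PropositionalEquality using (_≡_; refl; sym; trans; cong; cong₂; subst; subst₂)
open import Relation.Nullary using (¬_; Dec; does; yes; no; contradiction)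
open import Relation.Nullary.Decidable using (dec-true; decidable-stable; ¬¬-excluded-middle)

private variable
  k l m n m′ n′ : ℕ

-- Boolean tests

proof-of : ∀ {ℓ} {X : Set ℓ} (X? : Dec X) → does X? ≡ true → X
proof-of (yes x) _ = x

refutation-of : ∀ {ℓ} {X : Set ℓ} (X? : Dec X) → does X? ≡ false → ¬ X
refutation-of (no ¬x) _ = ¬x

some : (Fin n → Bool) → Bool
some p = does (F.any? λ i → p i Bool.≟ true)

some⁺ : (p : Fin n → Bool) (i : Fin n) → p i ≡ true → some p ≡ true
some⁺ p i pi = dec-true (F.any? λ i → p i Bool.≟ true) (i , pi)

some⁻ : (p : Fin n → Bool) → some p ≡ true → ∃ λ i → p i ≡ true
some⁻ p = proof-of (F.any? λ i → p i Bool.≟ true)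

b2n-mono : ∀ {p q} → (p ≡ true → q ≡ true) → b2n p ≤ b2n q
b2n-mono {false} _ = z≤n
b2n-mono {true} {true} _ = ≤-refl
b2n-mono {true} {false} h with () ← h refl

-- Sums and counts

sum-mono : {f g : Fin n → ℕ} → (∀ i → f i ≤ g i) → sum f ≤ sum g
sum-mono {zero}  f≤g = z≤n
sum-mono {suc n} f≤g = +-mono-≤ (f≤g zero) (sum-mono (f≤g ∘ suc))

sum-const : ∀ n c → sum {n} (λ _ → c) ≡ n * c
sum-const zero    c = refl
sum-const (suc n) c = cong (c +_) (sum-const n c)

term≤sum : (f : Fin n → ℕ) (i : Fin n) → f i ≤ sum f
term≤sum f zero    = m≤m+n _ _
term≤sum f (suc i) = ≤-trans (term≤sum (f ∘ suc) i) (m≤n+m _ _)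

count : (Fin n → Bool) → ℕ
count p = sum (b2n ∘ p)

count-mono : {p q : Fin n → Bool} → (∀ i → p i ≡ true → q i ≡ true) → count p ≤ count q
count-mono p⇒q = sum-mono λ i → b2n-mono (p⇒q i)

total : Matrix m n → ℕ
total A = sum λ i → count (A i)

listSum-map : (f : Fin n → ℕ) → List.sum (map f (allFin n)) ≡ sum f
listSum-map f = trans (cong List.sum (map-tabulate id f)) (listSum-tabulate f)
  where
  listSum-tabulate : ∀ {n} (g : Fin n → ℕ) → List.sum (tabulate g) ≡ sum g
  listSum-tabulate {zero}  g = refl
  listSum-tabulate {suc n} g = cong (g zero +_) (listSum-tabulate (g ∘ suc))

ones≡total : (A : Matrix m n) → ones A ≡ total A
ones≡total {m} A = trans (listSum-map {m} _) (sum-cong-≗ {m} λ i → listSum-map (b2n ∘ A i))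

total-flip : (A : Matrix m n) → total (flip A) ≡ total A
total-flip A = ∑-comm λ j i → b2n (A i j)

scaled-column-sums : ∀ b (A : Matrix m n) → b * total A ≡ sum (λ j → b * count (λ i → A i j))
scaled-column-sums {n = n} b A = trans (cong (b *_) (sym (total-flip A))) (*-distribˡ-sum {n} b _)

total≤area : (A : Matrix m n) → total A ≤ m * n
total≤area {m} {n} A = begin
  total A                ≤⟨ sum-mono {m} (λ i → sum-mono {n} λ j → b2n-mono {A i j} {true} λ _ → refl) ⟩
  sum {m} (λ i → sum {n} (λ _ → 1)) ≡⟨ sum-cong-≗ {m} (λ i → trans (sum-const n 1) (*-identityʳ n)) ⟩
  sum {m} (λ i → n)      ≡⟨ sum-const m n ⟩
  m * n                  ∎
  where open ≤-Reasoning

lift-increasing : (f : Fin m → Fin n) → StrictlyIncreasing f → StrictlyIncreasing (lift 1 f)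
lift-increasing f inc zero    (suc j) _   = z<s
lift-increasing f inc (suc i) (suc j) i<j = s<s (inc i j (s<s⁻¹ i<j))

select : (p : Fin n → Bool) (m : ℕ) → m ≤ count p →
  Σ (Fin m → Fin n) λ r → StrictlyIncreasing r × (∀ i → p (r i) ≡ true)
select p zero _ = (λ ()) , (λ ()) , λ ()
select {suc n} p (suc m) m<count with p zero in p₀
... | false =
  let r , inc , ok = select (p ∘ suc) (suc m) m<count
  in suc ∘ r , (λ i j → s<s ∘ inc i j) , ok
... | true =
  let r , inc , ok = select (p ∘ suc) m (s≤s⁻¹ m<count)
  in lift 1 r , lift-increasing r inc , λ { zero → p₀ ; (suc i) → ok i }

select₁ : (p : Fin n → Bool) → 1 ≤ count p → ∃ λ i → p i ≡ true
select₁ p 1≤count = let r , _ , ok = select p 1 1≤count in r zero , ok zero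

private
  take-head : ∀ x p q X m s → p + X * m ≤ q + X * s → x + p + X * suc m ≤ x + q + X * suc s
  take-head x p q X m s h = subst₂ _≤_ (eq x p X m) (eq x q X s) (+-monoʳ-≤ (x + X) h)
    where
    eq : ∀ x p X m → x + X + (p + X * m) ≡ x + p + X * suc m
    eq = solve-∀

-- Any m-set c with heavy ⊆ c ⊆ supp will do: the elements of supp ∖ c have weight at most X each.
-- The inequality is moved so that no subtraction occurs.
choose-heavy : (w : Fin n → ℕ) (heavy supp : Fin n → Bool) (X m : ℕ) →
  (∀ i → heavy i ≡ true → supp i ≡ true) → (∀ i → supp i ≡ false → w i ≡ 0) →
  (∀ i → heavy i ≡ false → w i ≤ X) → count heavy ≤ m → m ≤ count supp →
  Σ (Fin m → Fin n) λ c → StrictlyIncreasing c ×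
    sum w + X * m ≤ sum (w ∘ c) + X * count supp
choose-heavy {zero} w heavy supp X zero _ _ _ _ _ = (λ ()) , (λ ()) , ≤-refl
choose-heavy {suc n} w heavy supp X m h⊆s w₀ w≤X h≤m m≤s
  with supp zero in s₀ | heavy zero in h₀
... | false | true with () ← trans (sym s₀) (h⊆s zero h₀)
... | false | false =
  let c , inc , bound = choose-heavy (w ∘ suc) (heavy ∘ suc) (supp ∘ suc) X m
                          (h⊆s ∘ suc) (w₀ ∘ suc) (w≤X ∘ suc) h≤m m≤s
  in suc ∘ c , (λ i j → s<s ∘ inc i j)
   , subst (λ z → z + sum (w ∘ suc) + X * m ≤ sum (w ∘ suc ∘ c) + X * count (supp ∘ suc)) (sym (w₀ zero s₀)) bound
choose-heavy {suc n} w heavy supp X (suc m) h⊆s w₀ w≤X h≤m m≤s | true | true =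
  let c , inc , bound = choose-heavy (w ∘ suc) (heavy ∘ suc) (supp ∘ suc) X m
                          (h⊆s ∘ suc) (w₀ ∘ suc) (w≤X ∘ suc) (s≤s⁻¹ h≤m) (s≤s⁻¹ m≤s)
  in lift 1 c , lift-increasing c inc
   , take-head (w zero) (sum (w ∘ suc)) (sum (w ∘ suc ∘ c)) X m (count (supp ∘ suc)) bound
choose-heavy {suc n} w heavy supp X m h⊆s w₀ w≤X h≤m m≤s | true | false
  with m ≤? count (supp ∘ suc)
-- A light element is discarded while the rest of the support can still supply m elements; this
-- costs at most `X`.
... | yes m≤s′ =
  let c , inc , bound = choose-heavy (w ∘ suc) (heavy ∘ suc) (supp ∘ suc) X m
                          (h⊆s ∘ suc) (w₀ ∘ suc) (w≤X ∘ suc) h≤m m≤s′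
  in suc ∘ c , (λ i j → s<s ∘ inc i j)
   , skip-head (w zero) (sum (w ∘ suc)) (sum (w ∘ suc ∘ c)) X m (count (supp ∘ suc)) (w≤X zero h₀) bound
  where
  skip-head : ∀ x p q X m s → x ≤ X → p + X * m ≤ q + X * s → x + p + X * m ≤ q + X * suc s
  skip-head x p q X m s x≤X h =
    subst₂ _≤_ (sym (+-assoc x p (X * m))) (eq q X s) (+-mono-≤ x≤X h)
    where
    eq : ∀ q X s → X + (q + X * s) ≡ q + X * suc s
    eq = solve-∀
-- Here m equals the size of the whole remaining support, so all of it is chosen, this light element
-- included.
... | no m≰s′ with refl ← ≤-antisym m≤s (≰⇒> m≰s′) =
  let c , inc , bound = choose-heavy (w ∘ suc) (heavy ∘ suc) (supp ∘ suc) X (count (supp ∘ suc))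
                          (h⊆s ∘ suc) (w₀ ∘ suc) (w≤X ∘ suc) (count-mono (h⊆s ∘ suc)) ≤-refl
  in lift 1 c , lift-increasing c inc
   , take-head (w zero) (sum (w ∘ suc)) (sum (w ∘ suc ∘ c)) X (count (supp ∘ suc)) (count (supp ∘ suc)) bound

-- Contractions of matrices avoiding a permutation matrix

-- `R x i` says that line x of the large matrix may represent line i of the contraction. A relation,
-- unlike a map, lets lines stay unassigned once only some groups are selected.
ReflectsOrder : (Fin m → Fin n → Set) → Set
ReflectsOrder R = ∀ {x x′ i i′} → R x i → R x′ i′ → i F.< i′ → x F.< x′

-- Each one of the copy of `P` in `B` lifts to a one of `A`. No two ones of a permutation matrix
-- share a row or a column, so the lifts can be chosen independently; order reflection makes them a
-- copy of `P`.
contraction-contains : {P : SqMatrix k} → IsPermutationMatrix P →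
  (A : Matrix m n) (B : Matrix m′ n′) (R : Fin m → Fin m′ → Set) (S : Fin n → Fin n′ → Set) →
  ReflectsOrder R → ReflectsOrder S →
  (∀ i j → B i j ≡ true → ∃₂ λ x y → R x i × S y j × A x y ≡ true) →
  Contains B P → Contains A P
contraction-contains {k = k} {P = P} (rowP , colP) A B R S R-refl S-refl lifts (r , c , r-inc , c-inc , emb) =
  r′ , c′ , r′-inc , c′-inc , emb′
  where
  σ : Fin k → Fin k
  σ x = proj₁ (rowP x)

  τ : Fin k → Fin k
  τ y = proj₁ (colP y)

  στ : ∀ y → σ (τ y) ≡ y
  στ y = sym (proj₂ (proj₂ (rowP (τ y))) y (proj₁ (proj₂ (colP y))))

  witness : ∀ x → ∃₂ λ i j → R i (r x) × S j (c (σ x)) × A i j ≡ true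
  witness x = lifts (r x) (c (σ x)) (emb x (σ x) (proj₁ (proj₂ (rowP x))))

  r′ = λ x → proj₁ (witness x)
  -- Column y is placed by the one in row `τ y`, so both coordinates of a lifted one come from the
  -- same witness.
  c′ = λ y → proj₁ (proj₂ (witness (τ y)))

  r′-inc : StrictlyIncreasing r′
  r′-inc x x′ x<x′ = R-refl (proj₁ (proj₂ (proj₂ (witness x)))) (proj₁ (proj₂ (proj₂ (witness x′)))) (r-inc x x′ x<x′)

  S-c′ : ∀ y → S (c′ y) (c y)
  S-c′ y = subst (λ z → S (c′ y) (c z)) (στ y) (proj₁ (proj₂ (proj₂ (proj₂ (witness (τ y))))))

  c′-inc : StrictlyIncreasing c′
  c′-inc y y′ y<y′ = S-refl (S-c′ y) (S-c′ y′) (c-inc y y′ y<y′)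

  emb′ : ∀ x y → P x y ≡ true → A (r′ x) (c′ y) ≡ true
  emb′ x y Pxy with refl ← proj₂ (proj₂ (colP y)) x Pxy = proj₂ (proj₂ (proj₂ (proj₂ (witness x))))

submatrix-contains : {P : SqMatrix k} (A : Matrix m n) (r : Fin m′ → Fin m) (c : Fin n′ → Fin n) →
  StrictlyIncreasing r → StrictlyIncreasing c →
  Contains (λ i j → A (r i) (c j)) P → Contains A P
submatrix-contains A r c r-inc c-inc (r′ , c′ , r′-inc , c′-inc , emb) =
  r ∘ r′ , c ∘ c′ , (λ i j → r-inc _ _ ∘ r′-inc i j) , (λ i j → c-inc _ _ ∘ c′-inc i j) , emb

combine-monoʳ-< : (i : Fin m) {j j′ : Fin n} → j F.< j′ → combine i j F.< combine i j′
combine-monoʳ-< {n = n} i {j} {j′} j<j′ =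
  subst₂ _<_ (sym (F.toℕ-combine i j)) (sym (F.toℕ-combine i j′)) (+-monoʳ-< (n * toℕ i) j<j′)

-- Column density and the spread of dense rows

support : Matrix m n → Fin n → Bool
support A y = some λ x → A x y

-- This is ex(u, P) < (a / b) u², stated over all avoiding matrices so that no maximum has to be
-- exhibited.
Sparse : ℕ → ℕ → ℕ → SqMatrix k → Set
Sparse u a b P = ∀ (A : SqMatrix u) → Avoids A P → b * total A < a * (u * u)

module _ {u a b : ℕ} .{{_ : NonZero u}} .{{_ : NonZero a}}
         {k} {P : SqMatrix k} (perm : IsPermutationMatrix P) (sparse : Sparse u a b P) where

  -- The density of the whole matrix on its support is at most that of its u heaviest columns.
  sparse-wide : (C : Matrix u n) → Avoids C P → (s : Fin n → Bool) →
    (∀ j y → C j y ≡ true → s y ≡ true) → u ≤ count s → b * total C < (a * u) * count s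
  sparse-wide {n} C avoid s C⊆s u≤s with u ≤? count (λ y → does (a * u ≤? b * count (λ j → C j y)))
  -- A heavy column has density at least a / b; u of them would form a square matrix too dense for
  -- `sparse`.
  ... | yes u≤heavy =
    let c , inc , heavy = select _ u u≤heavy
        D = λ i j → C i (c j)
    in contradiction
         (sparse D (avoid ∘ submatrix-contains C id c (λ _ _ → id) inc))
         (≤⇒≯ (begin
           a * (u * u)                          ≡⟨ trans (sym (*-assoc a u u)) (*-comm (a * u) u) ⟩
           u * (a * u)                          ≡⟨ sum-const u (a * u) ⟨
           sum {u} (λ _ → a * u)                ≤⟨ sum-mono (λ i → proof-of (_ ≤? _) (heavy i)) ⟩
           sum (λ i → b * count (λ j → D j i))  ≡⟨ scaled-column-sums b D ⟨
           b * total D                          ∎))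
    where
    open ≤-Reasoning
  -- All heavy columns fit among u chosen ones, which together weigh less than `a * u * u`; every
  -- other column of the support weighs at most `a * u`.
  ... | no u≰heavy =
    let c , inc , bound = choose-heavy w heavy s (a * u) u heavy⊆s w₀ w≤X (<⇒≤ (≰⇒> u≰heavy)) u≤s
        D = λ i j → C i (c j)
        sparseD = sparse D (avoid ∘ submatrix-contains C id c (λ _ _ → id) inc)
    in +-cancelʳ-< (a * u * u) _ _ (begin-strict
         b * total C + a * u * u          ≡⟨ cong (_+ a * u * u) (scaled-column-sums b C) ⟩
         sum w + a * u * u                ≤⟨ bound ⟩
         sum (w ∘ c) + a * u * count s    ≡⟨ cong (_+ a * u * count s) (scaled-column-sums b D) ⟨
         b * total D + a * u * count s    <⟨ +-monoˡ-< (a * u * count s) sparseD ⟩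
         a * (u * u) + a * u * count s    ≡⟨ cong (_+ a * u * count s) (*-assoc a u u) ⟨
         a * u * u + a * u * count s      ≡⟨ +-comm (a * u * u) _ ⟩
         a * u * count s + a * u * u      ∎)
    where
    open ≤-Reasoning

    w : Fin n → ℕ
    w y = b * count (λ j → C j y)

    heavy : Fin n → Bool
    heavy y = does (a * u ≤? w y)

    w₀ : ∀ y → s y ≡ false → w y ≡ 0
    w₀ y sy = n≤0⇒n≡0 (begin
      w y                         ≤⟨ *-monoʳ-≤ b (count-mono {q = λ _ → false} λ j Cjy → trans (sym sy) (C⊆s j y Cjy)) ⟩
      b * count {u} (λ _ → false) ≡⟨ cong (b *_) (trans (sum-const u 0) (*-zeroʳ u)) ⟩
      b * 0                       ≡⟨ *-zeroʳ b ⟩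
      0                           ∎)

    heavy⊆s : ∀ y → heavy y ≡ true → s y ≡ true
    heavy⊆s y hy with s y in sy
    ... | true  = refl
    ... | false = contradiction (subst (a * u ≤_) (w₀ y sy) (proof-of (a * u ≤? w y) hy))
                    (<⇒≱ (>-nonZero⁻¹ (a * u) {{m*n≢0 a u}}))

    w≤X : ∀ y → heavy y ≡ false → w y ≤ a * u
    w≤X y hy = <⇒≤ (≰⇒> (refutation-of (a * u ≤? w y) hy))

  -- Reads u ≤ q^i N with q = a / b and N nonempty columns. Equality is possible at i = 0, while
  -- every contraction yields a strict inequality.
  DenseRowsSpread : ℕ → Set
  DenseRowsSpread i = ∀ {n} (A : Matrix (u ^ i) n) → Avoids A P → (∀ x → u ≤ count (A x)) →
    u * b ^ i ≤ count (support A) * a ^ i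

  -- Contract each of u consecutive groups of rows to a single row and compare with sparse-wide.
  dense-rows-spread-step : ∀ i → DenseRowsSpread i →
    (A : Matrix (u ^ suc i) n) → Avoids A P → (∀ x → u ≤ count (A x)) →
    u * b ^ suc i < count (support A) * a ^ suc i
  dense-rows-spread-step {n} i ih A avoid dense = *-cancelˡ-< u _ _ (begin-strict
    u * (u * (b * b ^ i))            ≡⟨ eq₁ u b (b ^ i) ⟩
    b * (u * (u * b ^ i))            ≤⟨ *-monoʳ-≤ b groups ⟩
    b * (total C * a ^ i)            ≡⟨ *-assoc b (total C) (a ^ i) ⟨
    b * total C * a ^ i              <⟨ *-monoˡ-< (a ^ i) {{m^n≢0 a i}} (sparse-wide C avoidC (support A) C⊆A u≤support) ⟩
    a * u * count (support A) * a ^ i ≡⟨ eq₂ a u (count (support A)) (a ^ i) ⟩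
    u * (count (support A) * (a * a ^ i)) ∎)
    where
    open ≤-Reasoning
    eq₁ : ∀ u b c → u * (u * (b * c)) ≡ b * (u * (u * c))
    eq₁ = solve-∀
    eq₂ : ∀ a u s c → a * u * s * c ≡ u * (s * (a * c))
    eq₂ = solve-∀

    group : Fin u → Matrix (u ^ i) n
    group j x = A (combine j x)

    C : Matrix u n
    C j = support (group j)

    group-avoids : ∀ j → Avoids (group j) P
    group-avoids j = avoid ∘ submatrix-contains A (combine j) id
      (λ x x′ x<x′ → combine-monoʳ-< j x<x′) (λ _ _ → id)

    -- Row j of `C` has one 1 per nonempty column of group j, so the induction hypothesis bounds
    -- each row sum of `C` from below.
    groups : u * (u * b ^ i) ≤ total C * a ^ i
    groups = begin
      u * (u * b ^ i)                   ≡⟨ sum-const u _ ⟨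
      sum {u} (λ _ → u * b ^ i)         ≤⟨ sum-mono (λ j → ih (group j) (group-avoids j) (dense ∘ combine j)) ⟩
      sum (λ j → count (C j) * a ^ i)   ≡⟨ *-distribʳ-sum (a ^ i) (λ j → count (C j)) ⟨
      total C * a ^ i                   ∎

    InGroup : Fin (u ^ suc i) → Fin u → Set
    InGroup x j = ∃ λ x′ → x ≡ combine j x′

    avoidC : Avoids C P
    avoidC = avoid ∘ contraction-contains perm A C InGroup _≡_
      (λ { (x , refl) (x′ , refl) j<j′ → F.combine-monoˡ-< x x′ j<j′ })
      (λ { refl refl → id })
      (λ j y Cjy → let x , Axy = some⁻ _ Cjy in combine j x , y , (x , refl) , refl , Axy)

    C⊆A : ∀ j y → C j y ≡ true → support A y ≡ true
    C⊆A j y Cjy = let x , Axy = some⁻ _ Cjy in some⁺ _ (combine j x) Axy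

    -- A single dense row already supplies the u nonempty columns that `sparse-wide` asks for.
    x₀ : Fin (u ^ suc i)
    x₀ = fromℕ< (m^n>0 u (suc i))

    u≤support : u ≤ count (support A)
    u≤support = ≤-trans (dense x₀) (count-mono λ y → some⁺ (λ x → A x y) x₀)

  dense-rows-spread : ∀ i → DenseRowsSpread i
  dense-rows-spread zero A _ dense =
    *-monoˡ-≤ 1 (≤-trans (dense zero) (count-mono λ y → some⁺ (λ x → A x y) zero))
  dense-rows-spread (suc i) A avoid dense =
    <⇒≤ (dense-rows-spread-step i (dense-rows-spread i) A avoid dense)

  -- In the application `V i` marks the nonempty columns of the i-th block in one column of blocks.
  -- The support of `u ^ suc t` dense rows would exceed u² columns, more than `s` has. The successor
  -- guarantees a contraction, hence strictness.
  few-dense-rows : ∀ t → u * a ^ suc t ≤ b ^ suc t →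
    (A : Matrix m n) → Avoids A P →
    (V : Matrix m′ n) (R : Fin m → Fin m′ → Set) → ReflectsOrder R →
    (∀ i y → V i y ≡ true → ∃ λ x → R x i × A x y ≡ true) →
    (s : Fin n → Bool) → (∀ i y → V i y ≡ true → s y ≡ true) → count s ≤ u * u →
    count (λ i → does (u ≤? count (V i))) ≤ u ^ suc t
  few-dense-rows t ua≤b A avoid V R R-refl lifts s V⊆s s≤u² =
    <⇒≤ (≰⇒> λ many →
    let r , inc , dense = select _ (u ^ suc t) many
        A′ = λ i → V (r i)
        avoid′ = avoid ∘ contraction-contains perm A A′ (λ x i → R x (r i)) _≡_
          (λ Rx Rx′ i<i′ → R-refl Rx Rx′ (inc _ _ i<i′)) (λ { refl refl → id })
          (λ i y Viy → let x , Rx , Axy = lifts (r i) y Viy in x , y , Rx , refl , Axy)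
    in <-irrefl refl (begin-strict
      u * b ^ suc t                          <⟨ dense-rows-spread-step t (dense-rows-spread t) A′ avoid′ (λ i → proof-of (_ ≤? _) (dense i)) ⟩
      count (support A′) * a ^ suc t         ≤⟨ *-monoˡ-≤ (a ^ suc t) (≤-trans (count-mono λ y hy → let i , Viy = some⁻ _ hy in V⊆s (r i) y Viy) s≤u²) ⟩
      u * u * a ^ suc t                      ≡⟨ *-assoc u u (a ^ suc t) ⟩
      u * (u * a ^ suc t)                    ≤⟨ *-monoʳ-≤ u ua≤b ⟩
      u * b ^ suc t                          ∎))
    where open ≤-Reasoning

-- Block decompositions

total≤rows*columns : (B : Matrix m n) → total B ≤ count (support (flip B)) * count (support B)
total≤rows*columns {m} {n} B = begin
  total B                                                  ≤⟨ sum-mono {m} row ⟩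
  sum {m} (λ x → b2n (support (flip B) x) * count (support B)) ≡⟨ *-distribʳ-sum {m} (count (support B)) (b2n ∘ support (flip B)) ⟨
  count (support (flip B)) * count (support B)             ∎
  where
  open ≤-Reasoning
  row : ∀ x → count (B x) ≤ b2n (support (flip B) x) * count (support B)
  row x with support (flip B) x in eq
  ... | true  = ≤-trans (count-mono {n} {B x} λ y → some⁺ (λ x → B x y) x) (≤-reflexive (sym (*-identityˡ _)))
  ... | false = ≤-trans (count-mono {n} {B x} {λ _ → false} λ y Bxy → trans (sym eq) (some⁺ (B x) y Bxy))
                        (≤-reflexive (trans (sum-const n 0) (*-zeroʳ n)))

-- p and q are the numbers of nonempty rows and columns of a block.
area-split : ∀ {p q s u} (nonempty : Dec (1 ≤ p)) (wide : Dec (u ≤ q)) (tall : Dec (u ≤ p)) → p ≤ s → q ≤ s →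
  p * q ≤ pred u * pred u * b2n (does nonempty) + s * s * b2n (does wide) + s * s * b2n (does tall)
area-split (no p≡0) _ _ _ _ with refl ← n<1⇒n≡0 (≰⇒> p≡0) = z≤n
area-split {s = s} (yes _) wide (yes _) p≤s q≤s =
  ≤-trans (*-mono-≤ p≤s q≤s) (≤-trans (≤-reflexive (sym (*-identityʳ (s * s)))) (m≤n+m _ _))
area-split {s = s} {u = u} (yes _) (yes _) (no _) p≤s q≤s =
  ≤-trans (*-mono-≤ p≤s q≤s) (≤-trans (≤-reflexive (sym (*-identityʳ (s * s))))
    (≤-trans (m≤n+m _ (pred u * pred u * 1)) (m≤m+n _ _)))
-- Neither dimension reaches u, so each is at most `pred u`.
area-split {u = u} (yes _) (no q<u) (no p<u) _ _ =
  ≤-trans (*-mono-≤ (<⇒≤pred (≰⇒> p<u)) (<⇒≤pred (≰⇒> q<u)))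
    (≤-trans (≤-reflexive (sym (*-identityʳ (pred u * pred u)))) (≤-trans (m≤m+n _ _) (m≤m+n _ _)))

sum-linear : ∀ α β γ (f g h : Fin n → ℕ) →
  sum (λ i → α * f i + β * g i + γ * h i) ≡ α * sum f + β * sum g + γ * sum h
sum-linear {n} α β γ f g h =
  trans (∑-distrib-+ {n} (λ i → α * f i + β * g i) (λ i → γ * h i))
    (cong₂ _+_
      (trans (∑-distrib-+ {n} (λ i → α * f i) (λ i → β * g i))
        (cong₂ _+_ (sym (*-distribˡ-sum {n} α f)) (sym (*-distribˡ-sum {n} β g))))
      (sym (*-distribˡ-sum {n} γ h)))

∑-rotate : (f : Fin k → Fin l → Fin m → ℕ) →
  sum (λ x → sum λ y → sum λ z → f x y z) ≡ sum (λ z → sum λ x → sum λ y → f x y z)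
∑-rotate {k} {l} {m} f = trans (sum-cong-≗ {k} λ x → ∑-comm {l} {m} (f x)) (∑-comm {k} {m} λ x z → sum {l} λ y → f x y z)

fibre : (Fin n → Fin m) → Fin m → Fin n → Bool
fibre ρ i x = does (ρ x F.≟ i)

module Blocks (A : SqMatrix n) (ρ : Fin n → Fin m) where

  -- Blocks keep the full size, with zeros outside their fibres: no reindexing arises and fibres may
  -- differ in size.
  block : Fin m → Fin m → SqMatrix n
  block i j x y = A x y ∧ (fibre ρ i x ∧ fibre ρ j y)

  block⁺ : ∀ x y → A x y ≡ true → block (ρ x) (ρ y) x y ≡ true
  block⁺ x y Axy = cong₂ _∧_ Axy (cong₂ _∧_ (dec-true (ρ x F.≟ ρ x) refl) (dec-true (ρ y F.≟ ρ y) refl))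

  block⇒A : ∀ {i j x y} → block i j x y ≡ true → A x y ≡ true
  block⇒A = Bool.∧-conicalˡ _ _

  block⇒row : ∀ {i j x y} → block i j x y ≡ true → fibre ρ i x ≡ true
  block⇒row {x = x} {y} = Bool.∧-conicalˡ _ _ ∘ Bool.∧-conicalʳ (A x y) _

  block⇒column : ∀ {i j x y} → block i j x y ≡ true → fibre ρ j y ≡ true
  block⇒column {i} {x = x} {y} = Bool.∧-conicalʳ (fibre ρ i x) _ ∘ Bool.∧-conicalʳ (A x y) _

  rows columns : Fin m → Fin m → ℕ
  rows    i j = count (support (flip (block i j)))
  columns i j = count (support (block i j))

  -- A one at (x, y) is counted in block (`ρ x`, `ρ y`), a single term of the sum over all blocks;
  -- the rotations then move the block indices outermost.
  total≤blocks : total A ≤ sum (λ i → sum λ j → total (block i j))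
  total≤blocks = begin
    total A
      ≤⟨ sum-mono {n} (λ x → sum-mono {n} λ y → ≤-trans (b2n-mono {A x y} (block⁺ x y))
           (≤-trans (term≤sum (λ j → f x y (ρ x) j) (ρ y)) (term≤sum (λ i → sum (f x y i)) (ρ x)))) ⟩
    sum (λ x → sum λ y → sum λ i → sum λ j → f x y i j)
      ≡⟨ ∑-rotate (λ x y i → sum (f x y i)) ⟩
    sum (λ i → sum λ x → sum λ y → sum λ j → f x y i j)
      ≡⟨ sum-cong-≗ {m} (λ i → ∑-rotate λ x y j → f x y i j) ⟩
    sum (λ i → sum λ j → total (block i j)) ∎
    where
    open ≤-Reasoning
    f : Fin n → Fin n → Fin m → Fin m → ℕ
    f x y i j = b2n (block i j x y)

  -- Nonemptiness is tested on the number of nonempty rows, the form `area-split` takes.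
  blockMatrix : SqMatrix m
  blockMatrix i j = does (1 ≤? rows i j)

  blockMatrix-avoids : {P : SqMatrix k} → IsPermutationMatrix P → ReflectsOrder (λ x i → ρ x ≡ i) →
    Avoids A P → Avoids blockMatrix P
  blockMatrix-avoids perm ρ-refl avoid = avoid ∘ contraction-contains perm A blockMatrix _ _ ρ-refl ρ-refl λ i j Cij →
    let x , nonempty = select₁ _ (proof-of (1 ≤? rows i j) Cij)
        y , Bxy = some⁻ _ nonempty
    in x , y , proof-of (ρ x F.≟ i) (block⇒row {i} {j} {x} {y} Bxy)
             , proof-of (ρ y F.≟ j) (block⇒column {i} {j} {x} {y} Bxy) , block⇒A {i} {j} {x} {y} Bxy

flip-permutation : {P : SqMatrix k} → IsPermutationMatrix P → IsPermutationMatrix (flip P)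
flip-permutation = swap

flip-contains : (A : Matrix m n) (B : Matrix k l) → Contains A B → Contains (flip A) (flip B)
flip-contains A B (r , c , r-inc , c-inc , emb) = c , r , c-inc , r-inc , flip emb

flip-sparse : ∀ {u} a b (P : SqMatrix k) → Sparse u a b P → Sparse u a b (flip P)
flip-sparse {u = u} a b P sparse A avoid =
  subst (λ z → b * z < a * (u * u)) (total-flip A) (sparse (flip A) (avoid ∘ flip-contains (flip A) P))

-- A nonempty block is wide (≥ u nonempty columns), tall (≥ u nonempty rows), or has at most (u − 1)² ones.
block-recurrence : ∀ {u a b t} .{{_ : NonZero u}} .{{_ : NonZero a}} {P : SqMatrix k} →
  IsPermutationMatrix P → Sparse u a b P → u * a ^ suc t ≤ b ^ suc t →
  (A : SqMatrix n) → Avoids A P → (ρ : Fin n → Fin m) → ReflectsOrder (λ x i → ρ x ≡ i) →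
  (∀ i → count (fibre ρ i) ≤ u * u) →
  total A ≤ pred u * pred u * total (Blocks.blockMatrix A ρ)
            + u * u * (u * u) * (m * u ^ suc t) + u * u * (u * u) * (m * u ^ suc t)
block-recurrence {n = n} {m = m} {u = u} {a} {b} {t} {P} perm sparse ua≤b A avoid ρ ρ-refl fibre≤ = begin
  total A
    ≤⟨ total≤blocks ⟩
  sum (λ i → sum λ j → total (block i j))
    ≤⟨ sum-mono {m} (λ i → sum-mono {m} λ j → ≤-trans (total≤rows*columns (block i j))
         (area-split (1 ≤? rows i j) (u ≤? columns i j) (u ≤? rows i j) (rows≤ i j) (columns≤ i j))) ⟩
  sum (λ i → sum λ j → α * b2n (C i j) + β * b2n (wide i j) + β * b2n (tall i j))
    ≡⟨ sum-cong-≗ {m} (λ i → sum-linear {m} α β β (b2n ∘ C i) (b2n ∘ wide i) (b2n ∘ tall i)) ⟩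
  sum (λ i → α * count (C i) + β * count (wide i) + β * count (tall i))
    ≡⟨ sum-linear {m} α β β (λ i → count (C i)) (λ i → count (wide i)) (λ i → count (tall i)) ⟩
  α * total C + β * total wide + β * total tall
    ≤⟨ +-mono-≤ (+-monoʳ-≤ (α * total C) (*-monoʳ-≤ β total-wide)) (*-monoʳ-≤ β total-tall) ⟩
  α * total C + β * (m * u ^ suc t) + β * (m * u ^ suc t) ∎
  where
  open ≤-Reasoning
  open Blocks A ρ
  α β : ℕ
  α = pred u * pred u
  β = u * u * (u * u)

  C wide tall : SqMatrix m
  C = blockMatrix
  wide i j = does (u ≤? columns i j)
  tall i j = does (u ≤? rows i j)

  support⊆fibre : ∀ i j y → support (block i j) y ≡ true → fibre ρ j y ≡ true
  support⊆fibre i j y h = let x , Bxy = some⁻ _ h in block⇒column {i} {j} {x} {y} Bxy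

  flip-support⊆fibre : ∀ i j x → support (flip (block i j)) x ≡ true → fibre ρ i x ≡ true
  flip-support⊆fibre i j x h = let y , Bxy = some⁻ _ h in block⇒row {i} {j} {x} {y} Bxy

  columns≤ : ∀ i j → columns i j ≤ u * u
  columns≤ i j = ≤-trans (count-mono (support⊆fibre i j)) (fibre≤ j)

  rows≤ : ∀ i j → rows i j ≤ u * u
  rows≤ i j = ≤-trans (count-mono (flip-support⊆fibre i j)) (fibre≤ i)

  total-wide : total wide ≤ m * u ^ suc t
  total-wide = begin
    total wide                  ≡⟨ total-flip wide ⟨
    -- For fixed j, contracting the rows of `A` and keeping only the columns in fibre j leaves a
    -- support of at most u² columns.
    total (flip wide)           ≤⟨ sum-mono {m} (λ j → few-dense-rows {b = b} perm sparse t ua≤b A avoid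
                                     (λ i → support (block i j)) (λ x i → ρ x ≡ i) ρ-refl
                                     (λ i y h → let x , Bxy = some⁻ _ h in
                                       x , proof-of (ρ x F.≟ i) (block⇒row {i} {j} {x} {y} Bxy) , block⇒A {i} {j} {x} {y} Bxy)
                                     (fibre ρ j) (λ i → support⊆fibre i j) (fibre≤ j)) ⟩
    sum {m} (λ _ → u ^ suc t)   ≡⟨ sum-const m _ ⟩
    m * u ^ suc t               ∎

  total-tall : total tall ≤ m * u ^ suc t
  total-tall = begin
    -- Tall blocks are the wide blocks of the transpose, which avoids `flip P`.
    total tall                  ≤⟨ sum-mono {m} (λ i → few-dense-rows {b = b} (flip-permutation perm) (flip-sparse a b P sparse) t ua≤b
                                     (flip A) (avoid ∘ flip-contains (flip A) (flip P))
                                     (λ j → support (flip (block i j))) (λ y j → ρ y ≡ j) ρ-refl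
                                     (λ j x h → let y , Bxy = some⁻ _ h in
                                       y , proof-of (ρ y F.≟ j) (block⇒column {i} {j} {x} {y} Bxy) , block⇒A {i} {j} {x} {y} Bxy)
                                     (fibre ρ i) (λ j → flip-support⊆fibre i j) (fibre≤ i)) ⟩
    sum {m} (λ _ → u ^ suc t)   ≡⟨ sum-const m _ ⟩
    m * u ^ suc t               ∎

-- Intervals and the linear bound

module Intervals {m s n} (n≤ms : n ≤ m * s) where

  -- Embedding into `Fin (m * s)` first allows n not divisible by s; trailing intervals may be
  -- short.
  interval : Fin n → Fin m
  interval x = quotient s (inject≤ x n≤ms)

  offset : Fin n → Fin s
  offset x = remainder {m} s (inject≤ x n≤ms)

  position : ∀ x → combine (interval x) (offset x) ≡ inject≤ x n≤ms
  position x = F.combine-remQuot {m} s (inject≤ x n≤ms)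

  interval-reflects : ReflectsOrder (λ x i → interval x ≡ i)
  interval-reflects {x} {x′} refl refl i<i′ =
    subst₂ _<_ (F.toℕ-inject≤ x n≤ms) (F.toℕ-inject≤ x′ n≤ms)
      (subst₂ F._<_ (position x) (position x′) (F.combine-monoˡ-< (offset x) (offset x′) i<i′))

  -- Among s + 1 elements of one interval two would share an offset, hence a position.
  fibre-interval : ∀ i → count (fibre interval i) ≤ s
  fibre-interval i = ≮⇒≥ λ s<count →
    let r , inc , ok = select (fibre interval i) (suc s) s<count
        x , x′ , x<x′ , same = F.pigeonhole ≤-refl (offset ∘ r)
        same-interval = trans (proof-of (interval (r x) F.≟ i) (ok x)) (sym (proof-of (interval (r x′) F.≟ i) (ok x′)))
        same-position = trans (sym (position (r x))) (trans (cong₂ combine same-interval same) (position (r x′)))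
    in <-irrefl (cong toℕ (F.inject≤-injective n≤ms n≤ms (r x) (r x′) same-position)) (inc x x′ x<x′)

-- Wide and tall blocks cost 2 q u⁴ `u ^ suc t` = K u q, so the recurrence gives K q (v² + u). As v²
-- + u = u² - v, a slack of q v absorbs the rounding of n up to q u². For n ≤ K the area bound
-- suffices.
linear-bound : ∀ v {a b t} .{{_ : NonZero a}} {P : SqMatrix k} → 1 ≤ v →
  IsPermutationMatrix P → Sparse (suc v) a b P → suc v * a ^ suc t ≤ b ^ suc t →
  ∀ n (A : SqMatrix n) → Avoids A P → total A ≤ 2 * suc v ^ 3 * suc v ^ suc t * n
linear-bound v {a} {b} {t} {P} 1≤v perm sparse ua≤b = <-rec _ bound
  where
  open ≤-Reasoning
  u s K : ℕ
  u = suc v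
  s = u * u
  K = 2 * u ^ 3 * u ^ suc t

  Bound : ℕ → Set
  Bound n = (A : SqMatrix n) → Avoids A P → total A ≤ K * n

  bound : ∀ n → (∀ {m} → m < n → Bound m) → Bound n
  bound n ih A avoid with n ≤? K
  ... | yes n≤K = ≤-trans (total≤area A) (*-monoˡ-≤ n n≤K)
  ... | no  n≰K = begin
    total A
      ≤⟨ block-recurrence {b = b} {t} perm sparse ua≤b A avoid interval interval-reflects fibre-interval ⟩
    v * v * total C + s * s * (q * u ^ suc t) + s * s * (q * u ^ suc t)
      ≤⟨ +-monoˡ-≤ _ (+-monoˡ-≤ _ (*-monoʳ-≤ (v * v) (ih q<n C (Blocks.blockMatrix-avoids A interval perm interval-reflects avoid)))) ⟩
    v * v * (K * q) + s * s * (q * u ^ suc t) + s * s * (q * u ^ suc t)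
      ≡⟨ eq₁ v q (u ^ suc t) ⟩
    K * (q * (v * v + v + 1))
      ≤⟨ *-monoʳ-≤ K qw≤n ⟩
    K * n ∎
    where
    q = suc (n / s)

    n≤qs : n ≤ q * s
    n≤qs = begin
      n                     ≡⟨ m≡m%n+[m/n]*n n s ⟩
      n % s + n / s * s     ≤⟨ +-monoˡ-≤ (n / s * s) (<⇒≤ (m%n<n n s)) ⟩
      q * s                 ∎

    open Intervals {q} {s} n≤qs
    C = Blocks.blockMatrix A interval

    eq₁ : ∀ v m p → let u = 1 + v; K = 2 * (u * (u * (u * 1))) * p in
      v * v * (K * m) + u * u * (u * u) * (m * p) + u * u * (u * u) * (m * p) ≡ K * (m * (v * v + v + 1))
    eq₁ = solve-∀

    eq₂ : ∀ v p → let u = 1 + v in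
      2 * (u * (u * (u * 1))) * (u * p) ≡ u * u * (u * u) * p + u * u * (u * u) * p
    eq₂ = solve-∀

    eq₃ : ∀ v q → q * (v * v + v + 1) + q * v ≡ q * ((1 + v) * (1 + v))
    eq₃ = solve-∀

    -- K is at least s², so n > K leaves more than s intervals.
    s<q : s < q
    s<q = *-cancelʳ-< s s q (begin-strict
      s * s                           ≤⟨ m≤m*n (s * s) (u ^ t) {{m^n≢0 u t}} ⟩
      s * s * u ^ t                   ≤⟨ m≤m+n _ _ ⟩
      s * s * u ^ t + s * s * u ^ t   ≡⟨ eq₂ v (u ^ t) ⟨
      K                               <⟨ ≰⇒> n≰K ⟩
      n                               ≤⟨ n≤qs ⟩
      q * s                           ∎)

    -- Rounding adds at most s, and s < q ≤ q v.
    qw≤n : q * (v * v + v + 1) ≤ n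
    qw≤n = +-cancelʳ-≤ (q * v) _ _ (begin
      q * (v * v + v + 1) + q * v  ≡⟨ eq₃ v q ⟩
      q * s                        ≤⟨ +-monoʳ-≤ s (m/n*n≤m n s) ⟩
      s + n                        ≤⟨ +-monoˡ-≤ n (≤-trans (<⇒≤ s<q) (m≤m*n q v {{>-nonZero 1≤v}})) ⟩
      q * v + n                    ≡⟨ +-comm (q * v) n ⟩
      n + q * v                    ∎)

    q<n : q < n
    q<n = begin-strict
      q                    <⟨ m<m*n q (v * v + v + 1) (+-monoˡ-≤ 1 (≤-trans 1≤v (m≤n+m v (v * v)))) ⟩
      q * (v * v + v + 1)  ≤⟨ qw≤n ⟩
      n                    ∎

-- Irrefutable existence of the maximum suffices, since an inequality derived from it is decidable.
extremal-irrefutable : ∀ {u} (P : SqMatrix k) g (A : SqMatrix u) → Avoids A P → u * u ≤ ones A + g →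
  ¬ ¬ (∃ λ e → IsEx u P e × ones A ≤ e)
extremal-irrefutable {u = u} P g A avoid gap ¬max = ¬¬-excluded-middle {A = ∃ λ A′ → Avoids A′ P × ones A < ones A′} λ
  { (no ¬better) → ¬max (ones A , ((A , avoid , refl) , λ A′ avoid′ → ≮⇒≥ λ A<A′ → ¬better (A′ , avoid′ , A<A′)) , ≤-refl)
  ; (yes (A′ , avoid′ , A<A′)) → improve g gap A′ avoid′ A<A′ }
  where
  open ≤-Reasoning
  -- `g` bounds the room left below the area u²; each better matrix uses up at least one unit.
  improve : ∀ g → u * u ≤ ones A + g → ∀ A′ → Avoids A′ P → ¬ ones A < ones A′
  improve zero gap A′ _ A<A′ = <-irrefl refl (begin-strict
    ones A      <⟨ A<A′ ⟩
    ones A′     ≡⟨ ones≡total A′ ⟩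
    total A′    ≤⟨ total≤area A′ ⟩
    u * u       ≤⟨ gap ⟩
    ones A + 0  ≡⟨ +-identityʳ _ ⟩
    ones A      ∎)
  improve (suc g) gap A′ avoid′ A<A′ = extremal-irrefutable P g A′ avoid′
    (begin
      u * u            ≤⟨ gap ⟩
      ones A + suc g   ≡⟨ +-suc (ones A) g ⟩
      suc (ones A) + g ≤⟨ +-monoˡ-≤ g A<A′ ⟩
      ones A′ + g      ∎)
    λ { (e , ex , A′≤e) → ¬max (e , ex , ≤-trans (<⇒≤ A<A′) A′≤e) }

-- The hypothesis speaks only of values known to be ex(u, P). The goal is a decidable inequality, so
-- an irrefutable maximum is enough; u² serves as the initial gap.
ex-bound⇒sparse : ∀ {u} a b (P : SqMatrix k) → (∀ e → IsEx u P e → b * e < a * (u * u)) → Sparse u a b P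
ex-bound⇒sparse {u = u} a b P ex< A avoid = decidable-stable (_ <? _) λ ≮ →
  extremal-irrefutable P (u * u) A avoid (m≤n+m _ _) λ { (e , ex , A≤e) →
    ≮ (≤-<-trans (*-monoʳ-≤ b (subst (_≤ e) (ones≡total A) A≤e)) (ex< e ex)) }

theorem1p5 : ∀ (u : ℕ) (a b : ℕ) → 0 < a → a < b → b < a * u →
    ∀ {k : ℕ} (P : SqMatrix k) → IsPermutationMatrix P →
    (∀ e → IsEx u P e → b * e < a * (u * u)) →
    ∀ (t : ℕ) → IsCeilLogRatio u a b t →
    FHLimitAtMost P (2 * u ^ 3 * u ^ t)
-- From 1/u < q < 1 follows u ≥ 2, and then u q^t ≤ 1 forces t ≥ 1; the first three clauses discard
-- the rest.
theorem1p5 zero a b _ _ b<a0 = contradiction (subst (b <_) (*-zeroʳ a) b<a0) λ ()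
theorem1p5 (suc zero) a b _ a<b b<a1 = contradiction (subst (b <_) (*-identityʳ a) b<a1) (<-asym a<b)
theorem1p5 (suc (suc v)) a b _ _ _ P _ _ zero (s≤s () , _)
theorem1p5 u@(suc v@(suc _)) a b 0<a _ _ P perm ex< (suc t) (ua≤b , _) d _ =
  -- The linear bound holds at every size, so the threshold is 0.
  0 , λ { n _ _ ((A , avoid , refl) , _) → begin
    d * ones A         ≡⟨ cong (d *_) (ones≡total A) ⟩
    d * total A        ≤⟨ *-monoʳ-≤ d (linear-bound v {b = b} {t} {{>-nonZero 0<a}} (s≤s z≤n) perm (ex-bound⇒sparse a b P ex<) ua≤b n A avoid) ⟩
    d * (K * n)        ≡⟨ *-assoc d K n ⟨
    d * K * n          ≤⟨ *-monoˡ-≤ n (m≤m+n (d * K) 1) ⟩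
    (d * K + 1) * n    ∎ }
  where
  open ≤-Reasoning
  K = 2 * u ^ 3 * u ^ suc t
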